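{- For every real $M\ge 1$, the addition $\boxplus$ on $[-M,M]$ is commutative but not associative; in particular $\mathbf{A}_{ -M,M}=([-M,M],\boxplus,\boxtimes,\le)$ is not a semiring.
   Context: On $[-M,M]$: $a\boxplus b$ equals $a+b$ if $a+b\in[-M,M]$, $M$ if $a+b>M$, and $-M$ if $a+b<-M$; $a\boxtimes b$ equals $a\times b$ if $a\times b\in[-M,M]$, $M$ if $a\times b>M$, and $-M$ if $a\times b<-M$. Here $+,\times,\le$ are the usual operations and order on $\mathbb{R}$. A semiring is required to have associative addition. -}

module Defs where

open import Algebra.Core using (Op₂)
open import Data.Nat.Base as ℕ using (ℕ)
import Data.Nat.Properties as ℕ
open import Data.Product.Base using (Σ; ∃-syntax; _×_; _,_; proj₁; proj₂)
open import Data.Rational.Base as ℚ using (ℚ; 0ℚ; 1ℚ; ½; Positive)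
import Data.Rational.Properties as ℚ
open import Data.Rational.Solver using (module +-*-Solver)
open import Data.Sum.Base using (inj₁; inj₂)
open import Relation.Binary.PropositionalEquality using (_≡_; refl; sym; cong; subst)

private
  module Identities where
    open import Data.Rational.Base using (_+_; _-_; _*_; -_)
    open +-*-Solver using (solve; _:=_; _:+_; _:-_; _:*_; :-_; con)

    abstract
      x≡y+[x-y] : ∀ x y → x ≡ y + (x - y)
      x≡y+[x-y] = solve 2 (λ x y → x := y :+ (x :- y)) refl

      y+e-y≡e : ∀ y e → y + e - y ≡ e
      y+e-y≡e = solve 2 (λ y e → y :+ e :- y := e) refl

      -[y-x]≡x-y : ∀ x y → - (y - x) ≡ x - y
      -[y-x]≡x-y = solve 2 (λ x y → :- (y :- x) := x :- y) refl

      y-x≡-x--y : ∀ x y → y - x ≡ (- x) - (- y)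
      y-x≡-x--y = solve 2 (λ x y → y :- x := (:- x) :- (:- y)) refl

      ½ε+½ε≡ε : ∀ ε → ½ * ε + ½ * ε ≡ ε
      ½ε+½ε≡ε = solve 1 (λ ε → con ½ :* ε :+ con ½ :* ε := ε) refl

      +-difference : ∀ a b c d → (a + b) - (c + d) ≡ (a - c) + (b - d)
      +-difference = solve 4 (λ a b c d → (a :+ b) :- (c :+ d) := (a :- c) :+ (b :- d)) refl

      *-difference : ∀ a b c d → a * b - c * d ≡ a * (b - d) + d * (a - c)
      *-difference = solve 4 (λ a b c d → a :* b :- c :* d := a :* (b :- d) :+ d :* (a :- c)) refl

      [a+e]+[a+e]-a≡a+[e+e] : ∀ a e → (a + e) + (a + e) - a ≡ a + (e + e)
      [a+e]+[a+e]-a≡a+[e+e] = solve 2 (λ a e → (a :+ e) :+ (a :+ e) :- a := a :+ (e :+ e)) refl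

  open Identities

  abstract
    module _ (p q ε : ℚ) where
      open ℚ.≤-Reasoning

      ∣-∣⇒≤ : ℚ.∣ p ℚ.- q ∣ ℚ.≤ ε → p ℚ.≤ q ℚ.+ ε
      ∣-∣⇒≤ h = begin
        p                       ≡⟨ x≡y+[x-y] p q ⟩
        q ℚ.+ (p ℚ.- q)         ≤⟨ ℚ.+-monoʳ-≤ q (p≤∣p∣ (p ℚ.- q)) ⟩
        q ℚ.+ ℚ.∣ p ℚ.- q ∣     ≤⟨ ℚ.+-monoʳ-≤ q h ⟩
        q ℚ.+ ε                 ∎
        where
        p≤∣p∣ : ∀ r → r ℚ.≤ ℚ.∣ r ∣
        p≤∣p∣ r with ℚ.≤-total 0ℚ r
        ... | inj₁ 0≤r = ℚ.≤-reflexive (sym (ℚ.0≤p⇒∣p∣≡p 0≤r))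
        ... | inj₂ r≤0 = ℚ.≤-trans r≤0 (ℚ.0≤∣p∣ r)

      ≤⇒-≤ : p ℚ.≤ q ℚ.+ ε → p ℚ.- q ℚ.≤ ε
      ≤⇒-≤ h = begin
        p ℚ.- q           ≤⟨ ℚ.+-monoˡ-≤ (ℚ.- q) h ⟩
        q ℚ.+ ε ℚ.- q     ≡⟨ y+e-y≡e q ε ⟩
        ε                 ∎

    ∣-∣-sym : ∀ p q → ℚ.∣ p ℚ.- q ∣ ≡ ℚ.∣ q ℚ.- p ∣
    ∣-∣-sym p q = subst (λ r → ℚ.∣ r ∣ ≡ ℚ.∣ q ℚ.- p ∣)
      (-[y-x]≡x-y p q) (ℚ.∣-p∣≡∣p∣ (q ℚ.- p))

    ∣-∣⇒≥ : ∀ p q ε → ℚ.∣ p ℚ.- q ∣ ℚ.≤ ε → q ℚ.≤ p ℚ.+ ε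
    ∣-∣⇒≥ p q ε h = ∣-∣⇒≤ q p ε (subst (ℚ._≤ ε) (∣-∣-sym p q) h)

    ≤∧≥⇒∣-∣ : ∀ p q ε → p ℚ.≤ q ℚ.+ ε → q ℚ.≤ p ℚ.+ ε → ℚ.∣ p ℚ.- q ∣ ℚ.≤ ε
    ≤∧≥⇒∣-∣ p q ε h k with ℚ.≤-total 0ℚ (p ℚ.- q)
    ... | inj₁ 0≤r = subst (ℚ._≤ ε) (sym (ℚ.0≤p⇒∣p∣≡p 0≤r)) (≤⇒-≤ p q ε h)
    ... | inj₂ r≤0 = subst (ℚ._≤ ε)
      (begin-equality
        q ℚ.- p              ≡⟨ -[y-x]≡x-y q p ⟨
        ℚ.- (p ℚ.- q)        ≡⟨ ℚ.0≤p⇒∣p∣≡p (ℚ.neg-antimono-≤ r≤0) ⟨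
        ℚ.∣ ℚ.- (p ℚ.- q) ∣  ≡⟨ ℚ.∣-p∣≡∣p∣ (p ℚ.- q) ⟩
        ℚ.∣ p ℚ.- q ∣        ∎)
      (≤⇒-≤ q p ε k)
      where
      open ℚ.≤-Reasoning

    p≤p+ε : ∀ p {ε} → 0ℚ ℚ.< ε → p ℚ.≤ p ℚ.+ ε
    p≤p+ε p {ε} 0<ε = subst (ℚ._≤ p ℚ.+ ε) (ℚ.+-identityʳ p) (ℚ.+-monoʳ-≤ p (ℚ.<⇒≤ 0<ε))

    0<½*ε : ∀ {ε} → 0ℚ ℚ.< ε → 0ℚ ℚ.< ½ ℚ.* ε
    0<½*ε {ε} 0<ε = subst (ℚ._< ½ ℚ.* ε) (ℚ.*-zeroʳ ½) (ℚ.*-monoʳ-<-pos ½ 0<ε)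

    ⊓-approx : ∀ p q r s ε → p ℚ.≤ r ℚ.+ ε → q ℚ.≤ s ℚ.+ ε →
               p ℚ.⊓ q ℚ.≤ r ℚ.⊓ s ℚ.+ ε
    ⊓-approx p q r s ε h k with ℚ.⊓-sel r s
    ... | inj₁ eq rewrite eq = ℚ.≤-trans (ℚ.p⊓q≤p p q) h
    ... | inj₂ eq rewrite eq = ℚ.≤-trans (ℚ.p⊓q≤q p q) k

    ⊔-approx : ∀ p q r s ε → p ℚ.≤ r ℚ.+ ε → q ℚ.≤ s ℚ.+ ε →
               p ℚ.⊔ q ℚ.≤ r ℚ.⊔ s ℚ.+ ε
    ⊔-approx p q r s ε h k = ℚ.⊔-lub
      (ℚ.≤-trans h (ℚ.+-monoˡ-≤ ε (ℚ.p≤p⊔q r s)))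
      (ℚ.≤-trans k (ℚ.+-monoˡ-≤ ε (ℚ.p≤q⊔p r s)))

    ⊓-close : ∀ a b c d ε → ℚ.∣ a ℚ.- c ∣ ℚ.≤ ε → ℚ.∣ b ℚ.- d ∣ ℚ.≤ ε →
              ℚ.∣ (a ℚ.⊓ b) ℚ.- (c ℚ.⊓ d) ∣ ℚ.≤ ε
    ⊓-close a b c d ε h k = ≤∧≥⇒∣-∣ (a ℚ.⊓ b) (c ℚ.⊓ d) ε
      (⊓-approx a b c d ε (∣-∣⇒≤ a c ε h) (∣-∣⇒≤ b d ε k))
      (⊓-approx c d a b ε (∣-∣⇒≥ a c ε h) (∣-∣⇒≥ b d ε k))

    ⊔-close : ∀ a b c d ε → ℚ.∣ a ℚ.- c ∣ ℚ.≤ ε → ℚ.∣ b ℚ.- d ∣ ℚ.≤ ε →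
              ℚ.∣ (a ℚ.⊔ b) ℚ.- (c ℚ.⊔ d) ∣ ℚ.≤ ε
    ⊔-close a b c d ε h k = ≤∧≥⇒∣-∣ (a ℚ.⊔ b) (c ℚ.⊔ d) ε
      (⊔-approx a b c d ε (∣-∣⇒≤ a c ε h) (∣-∣⇒≤ b d ε k))
      (⊔-approx c d a b ε (∣-∣⇒≥ a c ε h) (∣-∣⇒≥ b d ε k))

IsCauchy : (ℕ → ℚ) → Set
IsCauchy x = ∀ ε → 0ℚ ℚ.< ε →
  ∃[ N ] (∀ m n → N ℕ.≤ m → N ℕ.≤ n → ℚ.∣ x m ℚ.- x n ∣ ℚ.≤ ε)

-- Equality of real numbers is _≈_ below, not _≡_.
record ℝ : Set where
  constructor mkℝ
  field
    seq      : ℕ → ℚ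
    isCauchy : IsCauchy seq

open ℝ public

Eventually : (ℕ → Set) → Set
Eventually P = ∃[ N ] (∀ n → N ℕ.≤ n → P n)

infix 4 _≈_ _≤_ _<_

_≈_ _≤_ _<_ : ℝ → ℝ → Set
x ≈ y = ∀ ε → 0ℚ ℚ.< ε → Eventually (λ n → ℚ.∣ seq x n ℚ.- seq y n ∣ ℚ.≤ ε)
x ≤ y = ∀ ε → 0ℚ ℚ.< ε → Eventually (λ n → seq x n ℚ.≤ seq y n ℚ.+ ε)
x < y = ∃[ ε ] (0ℚ ℚ.< ε × Eventually (λ n → seq x n ℚ.+ ε ℚ.≤ seq y n))

private
  abstract
    combine : ∀ {P Q R : ℕ → Set} → (∀ n → P n → Q n → R n) →
              Eventually P → Eventually Q → Eventually R
    combine f (M , p) (N , q) = M ℕ.⊔ N , λ n h →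
      f n (p n (ℕ.≤-trans (ℕ.m≤m⊔n M N) h)) (q n (ℕ.≤-trans (ℕ.m≤n⊔m M N) h))

    always : ∀ {P : ℕ → Set} → (∀ n → P n) → Eventually P
    always p = 0 , λ n _ → p n

    const-cauchy : ∀ p → IsCauchy (λ _ → p)
    const-cauchy p ε 0<ε = 0 , λ _ _ _ _ →
      ≤∧≥⇒∣-∣ p p ε (p≤p+ε p 0<ε) (p≤p+ε p 0<ε)

fromℚ : ℚ → ℝ
fromℚ p = mkℝ (λ _ → p) (const-cauchy p)

0ℝ 1ℝ : ℝ
0ℝ = fromℚ 0ℚ
1ℝ = fromℚ 1ℚ

private
  abstract
    lift₂-cauchy : ∀ (x y : ℝ) (f : ℚ → ℚ → ℚ) (g : ℚ → ℚ) (h : ℚ → ℚ) →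
      (∀ {ε} → 0ℚ ℚ.< ε → 0ℚ ℚ.< g ε) → (∀ {ε} → 0ℚ ℚ.< ε → 0ℚ ℚ.< h ε) →
      (P : ℕ → Set) → Eventually P →
      (∀ m n ε → P m → P n →
        ℚ.∣ seq x m ℚ.- seq x n ∣ ℚ.≤ g ε → ℚ.∣ seq y m ℚ.- seq y n ∣ ℚ.≤ h ε →
        ℚ.∣ f (seq x m) (seq y m) ℚ.- f (seq x n) (seq y n) ∣ ℚ.≤ ε) →
      IsCauchy (λ n → f (seq x n) (seq y n))
    lift₂-cauchy x y f g h g>0 h>0 P (N₀ , p) step ε 0<ε
      with isCauchy x (g ε) (g>0 0<ε) | isCauchy y (h ε) (h>0 0<ε)
    ... | N₁ , u | N₂ , v = N₀ ℕ.⊔ (N₁ ℕ.⊔ N₂) , λ m n m≥ n≥ →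
      step m n ε (p m (≥₀ m≥)) (p n (≥₀ n≥)) (u m n (≥₁ m≥) (≥₁ n≥)) (v m n (≥₂ m≥) (≥₂ n≥))
      where
      ≥₀ : ∀ {n} → N₀ ℕ.⊔ (N₁ ℕ.⊔ N₂) ℕ.≤ n → N₀ ℕ.≤ n
      ≥₀ = ℕ.≤-trans (ℕ.m≤m⊔n _ _)
      ≥₁ : ∀ {n} → N₀ ℕ.⊔ (N₁ ℕ.⊔ N₂) ℕ.≤ n → N₁ ℕ.≤ n
      ≥₁ k = ℕ.≤-trans (ℕ.≤-trans (ℕ.m≤m⊔n N₁ N₂) (ℕ.m≤n⊔m N₀ _)) k
      ≥₂ : ∀ {n} → N₀ ℕ.⊔ (N₁ ℕ.⊔ N₂) ℕ.≤ n → N₂ ℕ.≤ n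
      ≥₂ k = ℕ.≤-trans (ℕ.≤-trans (ℕ.m≤n⊔m N₁ N₂) (ℕ.m≤n⊔m N₀ _)) k

    -- If B > 0, then ∣ p - q ∣ ≤ shrink B ε implies B * ∣ p - q ∣ ≤ ½ * ε.
    shrink : ∀ B .{{_ : Positive B}} → ℚ → ℚ
    shrink B ε = (ℚ.1/ B) {{ℚ.pos⇒nonZero B}} ℚ.* (½ ℚ.* ε)

    0<shrink : ∀ B .{{_ : Positive B}} {ε} → 0ℚ ℚ.< ε → 0ℚ ℚ.< shrink B ε
    0<shrink B {ε} 0<ε = subst (ℚ._< shrink B ε) (ℚ.*-zeroʳ 1/B)
      (ℚ.*-monoʳ-<-pos 1/B {{ℚ.1/pos⇒pos B}} (0<½*ε 0<ε))
      where
      1/B : ℚ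
      1/B = (ℚ.1/ B) {{ℚ.pos⇒nonZero B}}

    *-shrink : ∀ B .{{_ : Positive B}} ε → B ℚ.* shrink B ε ≡ ½ ℚ.* ε
    *-shrink B ε = begin-equality
      B ℚ.* (1/B ℚ.* (½ ℚ.* ε))  ≡⟨ ℚ.*-assoc B 1/B (½ ℚ.* ε) ⟨
      B ℚ.* 1/B ℚ.* (½ ℚ.* ε)    ≡⟨ cong (ℚ._* (½ ℚ.* ε)) (ℚ.*-inverseʳ B {{ℚ.pos⇒nonZero B}}) ⟩
      1ℚ ℚ.* (½ ℚ.* ε)           ≡⟨ ℚ.*-identityˡ _ ⟩
      ½ ℚ.* ε                    ∎
      where
      open ℚ.≤-Reasoning
      1/B : ℚ
      1/B = (ℚ.1/ B) {{ℚ.pos⇒nonZero B}}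

    bounded : ∀ x → ∃[ B ] (Positive B × Eventually (λ n → ℚ.∣ seq x n ∣ ℚ.≤ B))
    bounded x with isCauchy x 1ℚ (ℚ.positive⁻¹ 1ℚ)
    ... | N , h = ℚ.∣ xN ∣ ℚ.+ 1ℚ
                , ℚ.nonNeg+pos⇒pos ℚ.∣ xN ∣ {{ℚ.∣-∣-nonNeg xN}} 1ℚ
                , N , λ n N≤n → begin
      ℚ.∣ seq x n ∣                         ≡⟨ cong ℚ.∣_∣ (x≡y+[x-y] (seq x n) xN) ⟩
      ℚ.∣ xN ℚ.+ (seq x n ℚ.- xN) ∣         ≤⟨ ℚ.∣p+q∣≤∣p∣+∣q∣ xN (seq x n ℚ.- xN) ⟩
      ℚ.∣ xN ∣ ℚ.+ ℚ.∣ seq x n ℚ.- xN ∣     ≤⟨ ℚ.+-monoʳ-≤ ℚ.∣ xN ∣ (h n N N≤n ℕ.≤-refl) ⟩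
      ℚ.∣ xN ∣ ℚ.+ 1ℚ                       ∎
      where
      open ℚ.≤-Reasoning
      xN : ℚ
      xN = seq x N

    ∣*∣≤ : ∀ B .{{_ : Positive B}} p q ε → ℚ.∣ p ∣ ℚ.≤ B → ℚ.∣ q ∣ ℚ.≤ shrink B ε →
           ℚ.∣ p ℚ.* q ∣ ℚ.≤ ½ ℚ.* ε
    ∣*∣≤ B p q ε h k = begin
      ℚ.∣ p ℚ.* q ∣          ≡⟨ ℚ.∣p*q∣≡∣p∣*∣q∣ p q ⟩
      ℚ.∣ p ∣ ℚ.* ℚ.∣ q ∣    ≤⟨ ℚ.*-monoʳ-≤-nonNeg ℚ.∣ q ∣ {{ℚ.∣-∣-nonNeg q}} h ⟩
      B ℚ.* ℚ.∣ q ∣          ≤⟨ ℚ.*-monoˡ-≤-nonNeg B {{ℚ.pos⇒nonNeg B}} k ⟩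
      B ℚ.* shrink B ε       ≡⟨ *-shrink B ε ⟩
      ½ ℚ.* ε                ∎
      where open ℚ.≤-Reasoning

    *-close : ∀ B .{{_ : Positive B}} C .{{_ : Positive C}} a b c d ε →
      ℚ.∣ a ∣ ℚ.≤ B → ℚ.∣ d ∣ ℚ.≤ C →
      ℚ.∣ a ℚ.- c ∣ ℚ.≤ shrink C ε → ℚ.∣ b ℚ.- d ∣ ℚ.≤ shrink B ε →
      ℚ.∣ a ℚ.* b ℚ.- c ℚ.* d ∣ ℚ.≤ ε
    *-close B C a b c d ε ∣a∣≤B ∣d∣≤C h k = begin
      ℚ.∣ a ℚ.* b ℚ.- c ℚ.* d ∣                         ≡⟨ cong ℚ.∣_∣ (*-difference a b c d) ⟩
      ℚ.∣ a ℚ.* (b ℚ.- d) ℚ.+ d ℚ.* (a ℚ.- c) ∣         ≤⟨ ℚ.∣p+q∣≤∣p∣+∣q∣ (a ℚ.* (b ℚ.- d)) (d ℚ.* (a ℚ.- c)) ⟩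
      ℚ.∣ a ℚ.* (b ℚ.- d) ∣ ℚ.+ ℚ.∣ d ℚ.* (a ℚ.- c) ∣   ≤⟨ ℚ.+-mono-≤ (∣*∣≤ B a (b ℚ.- d) ε ∣a∣≤B k) (∣*∣≤ C d (a ℚ.- c) ε ∣d∣≤C h) ⟩
      ½ ℚ.* ε ℚ.+ ½ ℚ.* ε                               ≡⟨ ½ε+½ε≡ε ε ⟩
      ε                                                 ∎
      where open ℚ.≤-Reasoning

    +-close : ∀ a b c d ε → ℚ.∣ a ℚ.- c ∣ ℚ.≤ ½ ℚ.* ε → ℚ.∣ b ℚ.- d ∣ ℚ.≤ ½ ℚ.* ε →
      ℚ.∣ a ℚ.+ b ℚ.- (c ℚ.+ d) ∣ ℚ.≤ ε
    +-close a b c d ε h k = begin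
      ℚ.∣ a ℚ.+ b ℚ.- (c ℚ.+ d) ∣           ≡⟨ cong ℚ.∣_∣ (+-difference a b c d) ⟩
      ℚ.∣ (a ℚ.- c) ℚ.+ (b ℚ.- d) ∣         ≤⟨ ℚ.∣p+q∣≤∣p∣+∣q∣ (a ℚ.- c) (b ℚ.- d) ⟩
      ℚ.∣ a ℚ.- c ∣ ℚ.+ ℚ.∣ b ℚ.- d ∣       ≤⟨ ℚ.+-mono-≤ h k ⟩
      ½ ℚ.* ε ℚ.+ ½ ℚ.* ε                   ≡⟨ ½ε+½ε≡ε ε ⟩
      ε                                     ∎
      where open ℚ.≤-Reasoning

    +-cauchy : ∀ x y → IsCauchy (λ n → seq x n ℚ.+ seq y n)
    +-cauchy x y = lift₂-cauchy x y ℚ._+_ (½ ℚ.*_) (½ ℚ.*_) 0<½*ε 0<½*ε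
      (λ n → n ≡ n) (always (λ _ → refl))
      λ m n ε _ _ → +-close (seq x m) (seq y m) (seq x n) (seq y n) ε

    *-cauchy : ∀ x y → IsCauchy (λ n → seq x n ℚ.* seq y n)
    *-cauchy x y with bounded x | bounded y
    ... | B , B>0 , ∣x∣≤B | C , C>0 , ∣y∣≤C =
      lift₂-cauchy x y ℚ._*_ (shrink C {{C>0}}) (shrink B {{B>0}})
        (0<shrink C {{C>0}}) (0<shrink B {{B>0}})
        (λ n → ℚ.∣ seq x n ∣ ℚ.≤ B × ℚ.∣ seq y n ∣ ℚ.≤ C) (combine (λ _ → _,_) ∣x∣≤B ∣y∣≤C)
        λ m n ε (xm , _) (_ , yn) →
          *-close B {{B>0}} C {{C>0}} (seq x m) (seq y m) (seq x n) (seq y n) ε xm yn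

    neg-cauchy : ∀ x → IsCauchy (λ n → ℚ.- seq x n)
    neg-cauchy x ε 0<ε with isCauchy x ε 0<ε
    ... | N , h = N , λ m n m≥ n≥ → subst (ℚ._≤ ε)
      (cong ℚ.∣_∣ (y-x≡-x--y (seq x m) (seq x n))) (h n m n≥ m≥)

    ⊓-cauchy : ∀ x y → IsCauchy (λ n → seq x n ℚ.⊓ seq y n)
    ⊓-cauchy x y = lift₂-cauchy x y ℚ._⊓_ (λ ε → ε) (λ ε → ε) (λ h → h) (λ h → h)
      (λ n → n ≡ n) (always (λ _ → refl))
      λ m n ε _ _ → ⊓-close (seq x m) (seq y m) (seq x n) (seq y n) ε

    ⊔-cauchy : ∀ x y → IsCauchy (λ n → seq x n ℚ.⊔ seq y n)
    ⊔-cauchy x y = lift₂-cauchy x y ℚ._⊔_ (λ ε → ε) (λ ε → ε) (λ h → h) (λ h → h)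
      (λ n → n ≡ n) (always (λ _ → refl))
      λ m n ε _ _ → ⊔-close (seq x m) (seq y m) (seq x n) (seq y n) ε

infix  8 -_
infixl 7 _*_ _⊓_
infixl 6 _+_ _⊔_

-_ : ℝ → ℝ
- x = mkℝ (λ n → ℚ.- seq x n) (neg-cauchy x)

_+_ _*_ _⊓_ _⊔_ : ℝ → ℝ → ℝ
x + y = mkℝ (λ n → seq x n ℚ.+ seq y n) (+-cauchy x y)
x * y = mkℝ (λ n → seq x n ℚ.* seq y n) (*-cauchy x y)
x ⊓ y = mkℝ (λ n → seq x n ℚ.⊓ seq y n) (⊓-cauchy x y)
x ⊔ y = mkℝ (λ n → seq x n ℚ.⊔ seq y n) (⊔-cauchy x y)

InRange : ℝ → ℝ → Set
InRange M x = (- M ≤ x) × (x ≤ M)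

Interval : ℝ → Set
Interval M = Σ ℝ (InRange M)

-- The case distinction is stated as a specification, because the order on ℝ
-- is not decidable and so the three cases cannot be used to compute a total
-- function.  Equality on ℝ is ¬¬-stable, so the clauses determine _⊙_ up to
-- _≈_; that such an operation exists is shown by `truncate` below.
record IsTruncationOf (M : ℝ) (_∙_ : Op₂ ℝ) (_⊙_ : Op₂ (Interval M)) : Set where
  field
    inside : ∀ a b → InRange M (proj₁ a ∙ proj₁ b) → proj₁ (a ⊙ b) ≈ proj₁ a ∙ proj₁ b
    above  : ∀ a b → M < proj₁ a ∙ proj₁ b         → proj₁ (a ⊙ b) ≈ M
    below  : ∀ a b → proj₁ a ∙ proj₁ b < - M       → proj₁ (a ⊙ b) ≈ - M

record TruncatedAlgebra (M : ℝ) : Set where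
  infix  4 _≈ᴵ_ _≤ᴵ_
  infixl 7 _⊠_
  infixl 6 _⊞_
  field
    _⊞_ _⊠_          : Op₂ (Interval M)
    ⊞-isTruncationOf : IsTruncationOf M _+_ _⊞_
    ⊠-isTruncationOf : IsTruncationOf M _*_ _⊠_

  _≈ᴵ_ _≤ᴵ_ : Interval M → Interval M → Set
  a ≈ᴵ b = proj₁ a ≈ proj₁ b
  a ≤ᴵ b = proj₁ a ≤ proj₁ b

module _ (M : ℝ) (0≤M : 0ℝ ≤ M) where

  private
    clamp : ℝ → ℝ
    clamp z = (z ⊓ M) ⊔ (- M)

    abstract
      -M≤M : ∀ ε → 0ℚ ℚ.< ε → Eventually (λ n → ℚ.- seq M n ℚ.≤ seq M n ℚ.+ ε)
      -M≤M ε 0<ε with 0≤M (½ ℚ.* ε) (0<½*ε 0<ε)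
      ... | N , h = N , λ n N≤n → let m = seq M n; δ = ½ ℚ.* ε in begin
        ℚ.- m                            ≡⟨ ℚ.+-identityˡ (ℚ.- m) ⟨
        0ℚ ℚ.- m                         ≤⟨ ℚ.+-monoˡ-≤ (ℚ.- m) (ℚ.+-mono-≤ (h n N≤n) (h n N≤n)) ⟩
        (m ℚ.+ δ) ℚ.+ (m ℚ.+ δ) ℚ.- m    ≡⟨ [a+e]+[a+e]-a≡a+[e+e] m δ ⟩
        m ℚ.+ (δ ℚ.+ δ)                  ≡⟨ cong (m ℚ.+_) (½ε+½ε≡ε ε) ⟩
        m ℚ.+ ε                          ∎
        where open ℚ.≤-Reasoning

      module _ (z : ℝ) (n : ℕ) {ε : ℚ} (0<ε : 0ℚ ℚ.< ε) where
        private
          p m c : ℚ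
          p = seq z n
          m = seq M n
          c = seq (clamp z) n

        c≤z+ε : ℚ.- m ℚ.≤ p ℚ.+ ε → c ℚ.≤ p ℚ.+ ε
        c≤z+ε = ℚ.⊔-lub (ℚ.≤-trans (ℚ.p⊓q≤p p m) (p≤p+ε p 0<ε))

        z≤c+ε : p ℚ.≤ m ℚ.+ ε → p ℚ.≤ c ℚ.+ ε
        z≤c+ε h = ℚ.≤-trans
          (subst (ℚ._≤ p ℚ.⊓ m ℚ.+ ε) (ℚ.⊓-idem p) (⊓-approx p p p m ε (p≤p+ε p 0<ε) h))
          (ℚ.+-monoˡ-≤ ε (ℚ.p≤p⊔q (p ℚ.⊓ m) (ℚ.- m)))

        c≤M+ε : ℚ.- m ℚ.≤ m ℚ.+ ε → c ℚ.≤ m ℚ.+ ε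
        c≤M+ε = ℚ.⊔-lub (ℚ.≤-trans (ℚ.p⊓q≤q p m) (p≤p+ε m 0<ε))

        M≤c+ε : m ℚ.≤ p → m ℚ.≤ c ℚ.+ ε
        M≤c+ε h = ℚ.≤-trans
          (ℚ.≤-trans (ℚ.⊓-glb h ℚ.≤-refl) (ℚ.p≤p⊔q (p ℚ.⊓ m) (ℚ.- m)))
          (p≤p+ε c 0<ε)

        c≤-M+ε : p ℚ.≤ ℚ.- m → c ℚ.≤ ℚ.- m ℚ.+ ε
        c≤-M+ε h = ℚ.≤-trans
          (ℚ.⊔-lub (ℚ.≤-trans (ℚ.p⊓q≤p p m) h) ℚ.≤-refl)
          (p≤p+ε (ℚ.- m) 0<ε)

        -M≤c+ε : ℚ.- m ℚ.≤ c ℚ.+ ε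
        -M≤c+ε = ℚ.≤-trans (ℚ.p≤q⊔p (p ℚ.⊓ m) (ℚ.- m)) (p≤p+ε c 0<ε)

      clamp-inRange : ∀ z → InRange M (clamp z)
      clamp-inRange z =
        (λ ε 0<ε → always λ n → -M≤c+ε z n 0<ε) ,
        (λ ε 0<ε → let N , h = -M≤M ε 0<ε in N , λ n N≤n → c≤M+ε z n 0<ε (h n N≤n))

      clamp-inside : ∀ z → InRange M z → clamp z ≈ z
      clamp-inside z (-M≤z , z≤M) ε 0<ε = combine
        (λ n l u → ≤∧≥⇒∣-∣ (seq (clamp z) n) (seq z n) ε (c≤z+ε z n 0<ε l) (z≤c+ε z n 0<ε u))
        (-M≤z ε 0<ε) (z≤M ε 0<ε)

      clamp-above : ∀ z → M < z → clamp z ≈ M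
      clamp-above z (δ , 0<δ , M+δ≤z) ε 0<ε = combine
        (λ n h k → ≤∧≥⇒∣-∣ (seq (clamp z) n) (seq M n) ε
          (c≤M+ε z n 0<ε k)
          (M≤c+ε z n 0<ε (ℚ.≤-trans (p≤p+ε (seq M n) 0<δ) h)))
        M+δ≤z (-M≤M ε 0<ε)

      clamp-below : ∀ z → z < - M → clamp z ≈ - M
      clamp-below z (δ , 0<δ , N , z+δ≤-M) ε 0<ε = N , λ n N≤n →
        ≤∧≥⇒∣-∣ (seq (clamp z) n) (ℚ.- seq M n) ε
          (c≤-M+ε z n 0<ε (ℚ.≤-trans (p≤p+ε (seq z n) 0<δ) (z+δ≤-M n N≤n)))
          (-M≤c+ε z n 0<ε)

  truncate : Op₂ ℝ → Op₂ (Interval M)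
  truncate _∙_ (a , _) (b , _) = clamp (a ∙ b) , clamp-inRange (a ∙ b)

  truncate-isTruncationOf : ∀ _∙_ → IsTruncationOf M _∙_ (truncate _∙_)
  truncate-isTruncationOf _∙_ = record
    { inside = λ (a , _) (b , _) → clamp-inside (a ∙ b)
    ; above  = λ (a , _) (b , _) → clamp-above (a ∙ b)
    ; below  = λ (a , _) (b , _) → clamp-below (a ∙ b)
    }

  truncatedAlgebra : TruncatedAlgebra M
  truncatedAlgebra = record
    { _⊞_              = truncate _+_
    ; _⊠_              = truncate _*_
    ; ⊞-isTruncationOf = truncate-isTruncationOf _+_
    ; ⊠-isTruncationOf = truncate-isTruncationOf _*_
    }

{-# OPTIONS --safe #-}

-- If a ⊙ b < b ⊙ a, then a ∙ b is neither above M nor below - M, as in both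
-- cases a ⊙ b and b ⊙ a coincide; hence a ∙ b is in range, where they coincide
-- as well.  Since ¬ x < y implies y ≤ x for Cauchy sequences, this makes the
-- truncation of a commutative operation commutative.  Associativity of ⊞ fails
-- on M, M, - M: (M ⊞ M) ⊞ - M ≈ M ⊞ - M ≈ 0, but M ⊞ (M ⊞ - M) ≈ M ⊞ 0 ≈ M.
module Submission where

open import Defs
open import Algebra.Definitions using (Commutative; Associative)
open import Algebra.Structures using (IsSemiring)
open import Data.Product.Base using (_×_; ∃₂)
open import Relation.Nullary.Negation.Core using (¬_)

open import Algebra.Core using (Op₂)
open import Data.Empty using (⊥; ⊥-elim)
open import Data.Integer.Base using (+_)
open import Data.Nat.Base as ℕ using (ℕ)
import Data.Nat.Properties as ℕ
open import Data.Product.Base using (_,_; proj₁; proj₂; map₂)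
open import Data.Rational.Base as ℚ using (ℚ; 0ℚ; 1ℚ; ½)
import Data.Rational.Properties as ℚ
open import Data.Rational.Solver using (module +-*-Solver)
open import Data.Sum.Base using (inj₁; inj₂)
open import Function.Base using (_∘_; _on_)
open import Relation.Binary.PropositionalEquality using (_≡_; refl; sym; cong; subst)
open import Relation.Nullary.Decidable.Core using (yes; no)

open +-*-Solver using (solve; _:=_; _:+_; _:-_; _:*_; :-_; con)

private
  variable
    w x y z : ℝ

-- Inequalities between rationals

⅕ : ℚ
⅕ = + 1 ℚ./ 5

0<r*p : ∀ r .{{_ : ℚ.Positive r}} {p} → 0ℚ ℚ.< p → 0ℚ ℚ.< r ℚ.* p
0<r*p r {p} 0<p = subst (ℚ._< r ℚ.* p) (ℚ.*-zeroʳ r) (ℚ.*-monoʳ-<-pos r 0<p)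

p<p+r : ∀ p {r} → 0ℚ ℚ.< r → p ℚ.< p ℚ.+ r
p<p+r p {r} 0<r = subst (ℚ._< p ℚ.+ r) (ℚ.+-identityʳ p) (ℚ.+-monoʳ-< p 0<r)

p≤∣p∣ : ∀ p → p ℚ.≤ ℚ.∣ p ∣
p≤∣p∣ p with ℚ.≤-total 0ℚ p
... | inj₁ 0≤p = ℚ.≤-reflexive (sym (ℚ.0≤p⇒∣p∣≡p 0≤p))
... | inj₂ p≤0 = ℚ.≤-trans p≤0 (ℚ.0≤∣p∣ p)

module _ (p q r : ℚ) where
  open ℚ.≤-Reasoning

  p-q≤r⇒p≤q+r : p ℚ.- q ℚ.≤ r → p ℚ.≤ q ℚ.+ r
  p-q≤r⇒p≤q+r h = begin
    p                ≡⟨ solve 2 (λ p q → p := q :+ (p :- q)) refl p q ⟩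
    q ℚ.+ (p ℚ.- q)  ≤⟨ ℚ.+-monoʳ-≤ q h ⟩
    q ℚ.+ r          ∎

  p≤q+r⇒p-q≤r : p ℚ.≤ q ℚ.+ r → p ℚ.- q ℚ.≤ r
  p≤q+r⇒p-q≤r h = begin
    p ℚ.- q        ≤⟨ ℚ.+-monoˡ-≤ (ℚ.- q) h ⟩
    q ℚ.+ r ℚ.- q  ≡⟨ solve 2 (λ q r → q :+ r :- q := r) refl q r ⟩
    r              ∎

-- With its converse below, the bridge between the two-sided closeness in `IsCauchy` and `_≈_` and
-- the one-sided bounds that define `_≤_`.
∣p-q∣≤r⇒p≤q+r : ∀ p q {r} → ℚ.∣ p ℚ.- q ∣ ℚ.≤ r → p ℚ.≤ q ℚ.+ r
∣p-q∣≤r⇒p≤q+r p q {r} h = p-q≤r⇒p≤q+r p q r (ℚ.≤-trans (p≤∣p∣ (p ℚ.- q)) h)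

p≤q+r∧q≤p+r⇒∣p-q∣≤r : ∀ p q {r} → p ℚ.≤ q ℚ.+ r → q ℚ.≤ p ℚ.+ r → ℚ.∣ p ℚ.- q ∣ ℚ.≤ r
p≤q+r∧q≤p+r⇒∣p-q∣≤r p q {r} h k with ℚ.∣p∣≡p∨∣p∣≡-p (p ℚ.- q)
... | inj₁ eq rewrite eq = p≤q+r⇒p-q≤r p q r h
... | inj₂ eq rewrite eq = subst (ℚ._≤ r)
  (solve 2 (λ p q → q :- p := :- (p :- q)) refl p q) (p≤q+r⇒p-q≤r q p r k)

∣p-q∣≡∣q-p∣ : ∀ p q → ℚ.∣ p ℚ.- q ∣ ≡ ℚ.∣ q ℚ.- p ∣
∣p-q∣≡∣q-p∣ p q = subst (λ r → ℚ.∣ r ∣ ≡ ℚ.∣ q ℚ.- p ∣)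
  (solve 2 (λ p q → :- (q :- p) := p :- q) refl p q) (ℚ.∣-p∣≡∣p∣ (q ℚ.- p))

combine : ∀ {P Q R : ℕ → Set} → (∀ n → P n → Q n → R n) →
          Eventually P → Eventually Q → Eventually R
combine f (M , p) (N , q) = M ℕ.⊔ N , λ n h →
  f n (p n (ℕ.m⊔n≤o⇒m≤o M N h)) (q n (ℕ.m⊔n≤o⇒n≤o M N h))

-- Order and equality of Cauchy reals

pointwise⇒≤ : (∀ n → seq x n ≡ seq y n) → x ≤ y
pointwise⇒≤ {x} {y} eq ε 0<ε = 0 , λ n _ →
  subst (ℚ._≤ seq y n ℚ.+ ε) (sym (eq n)) (ℚ.<⇒≤ (p<p+r (seq y n) 0<ε))

≤-refl : x ≤ x
≤-refl {x} = pointwise⇒≤ {x} {x} λ _ → refl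

≤-trans : x ≤ y → y ≤ z → x ≤ z
≤-trans {x} {y} {z} x≤y y≤z ε 0<ε = combine
  (λ n h k → begin
    seq x n                                ≤⟨ h ⟩
    seq y n ℚ.+ ½ ℚ.* ε                    ≤⟨ ℚ.+-monoˡ-≤ (½ ℚ.* ε) k ⟩
    seq z n ℚ.+ ½ ℚ.* ε ℚ.+ ½ ℚ.* ε
      ≡⟨ solve 2 (λ z ε → z :+ con ½ :* ε :+ con ½ :* ε := z :+ ε) refl (seq z n) ε ⟩
    seq z n ℚ.+ ε                          ∎)
  (x≤y (½ ℚ.* ε) (0<r*p ½ 0<ε)) (y≤z (½ ℚ.* ε) (0<r*p ½ 0<ε))
  where open ℚ.≤-Reasoning

+-mono-≤ : w ≤ x → y ≤ z → w + y ≤ x + z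
+-mono-≤ {w} {x} {y} {z} w≤x y≤z ε 0<ε = combine
  (λ n h k → begin
    seq w n ℚ.+ seq y n                                      ≤⟨ ℚ.+-mono-≤ h k ⟩
    (seq x n ℚ.+ ½ ℚ.* ε) ℚ.+ (seq z n ℚ.+ ½ ℚ.* ε)
      ≡⟨ solve 3 (λ x z ε → (x :+ con ½ :* ε) :+ (z :+ con ½ :* ε) := (x :+ z) :+ ε) refl
               (seq x n) (seq z n) ε ⟩
    (seq x n ℚ.+ seq z n) ℚ.+ ε                              ∎)
  (w≤x (½ ℚ.* ε) (0<r*p ½ 0<ε)) (y≤z (½ ℚ.* ε) (0<r*p ½ 0<ε))
  where open ℚ.≤-Reasoning

≤-antisym : x ≤ y → y ≤ x → x ≈ y
≤-antisym {x} {y} x≤y y≤x ε 0<ε = combine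
  (λ n → p≤q+r∧q≤p+r⇒∣p-q∣≤r (seq x n) (seq y n)) (x≤y ε 0<ε) (y≤x ε 0<ε)

≈⇒≤ : x ≈ y → x ≤ y
≈⇒≤ {x} {y} x≈y ε 0<ε =
  map₂ (λ h n N≤n → ∣p-q∣≤r⇒p≤q+r (seq x n) (seq y n) (h n N≤n)) (x≈y ε 0<ε)

≈-sym : x ≈ y → y ≈ x
≈-sym {x} {y} x≈y ε 0<ε =
  map₂ (λ h n N≤n → subst (ℚ._≤ ε) (∣p-q∣≡∣q-p∣ (seq x n) (seq y n)) (h n N≤n)) (x≈y ε 0<ε)

-- Going through the two inequalities leaves the splitting of the tolerance to `≤-trans`.
≈-trans : x ≈ y → y ≈ z → x ≈ z
≈-trans {x} {y} {z} x≈y y≈z = ≤-antisym {x} {z}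
  (≤-trans {x} {y} {z} (≈⇒≤ {x} {y} x≈y) (≈⇒≤ {y} {z} y≈z))
  (≤-trans {z} {y} {x} (≈⇒≤ {z} {y} (≈-sym {y} {z} y≈z)) (≈⇒≤ {y} {x} (≈-sym {x} {y} x≈y)))

-- Addition and negation act termwise on sequences, so laws of rational arithmetic carry over to `ℝ`
-- in this way.
pointwise⇒≈ : (∀ n → seq x n ≡ seq y n) → x ≈ y
pointwise⇒≈ {x} {y} eq =
  ≤-antisym {x} {y} (pointwise⇒≤ {x} {y} eq) (pointwise⇒≤ {y} {x} (sym ∘ eq))

≈-refl : x ≈ x
≈-refl {x} = pointwise⇒≈ {x} {x} λ _ → refl

-- Monotonicity used in both directions replaces an estimate of absolute values.
+-cong : w ≈ x → y ≈ z → w + y ≈ x + z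
+-cong {w} {x} {y} {z} w≈x y≈z = ≤-antisym {w + y} {x + z}
  (+-mono-≤ {w} {x} {y} {z} (≈⇒≤ {w} {x} w≈x) (≈⇒≤ {y} {z} y≈z))
  (+-mono-≤ {x} {w} {z} {y} (≈⇒≤ {x} {w} (≈-sym {w} {x} w≈x)) (≈⇒≤ {z} {y} (≈-sym {y} {z} y≈z)))

+-comm : ∀ x y → x + y ≈ y + x
+-comm x y = pointwise⇒≈ {x + y} {y + x} λ n → ℚ.+-comm (seq x n) (seq y n)

+-identityʳ : ∀ x → x + 0ℝ ≈ x
+-identityʳ x = pointwise⇒≈ {x + 0ℝ} {x} λ n → ℚ.+-identityʳ (seq x n)

+-inverseʳ : ∀ x → x + - x ≈ 0ℝ
+-inverseʳ x = pointwise⇒≈ {x + - x} {0ℝ} λ n → ℚ.+-inverseʳ (seq x n)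

-- A strict inequality carries a gap `ε`. Asking for the weak one at tolerance `½ε` spends half of
-- this gap and keeps the other half.
<-≤-trans : x < y → y ≤ z → x < z
<-≤-trans {x} {y} {z} (ε , 0<ε , x<y) y≤z = ½ε , 0<r*p ½ 0<ε , combine
  (λ n h k → begin
    seq x n ℚ.+ ½ε
      ≡⟨ solve 2 (λ x ε → x :+ con ½ :* ε := (x :+ ε) :- con ½ :* ε) refl (seq x n) ε ⟩
    seq x n ℚ.+ ε ℚ.- ½ε     ≤⟨ ℚ.+-monoˡ-≤ (ℚ.- ½ε) (ℚ.≤-trans h k) ⟩
    seq z n ℚ.+ ½ε ℚ.- ½ε    ≡⟨ solve 2 (λ z δ → z :+ δ :- δ := z) refl (seq z n) ½ε ⟩
    seq z n                  ∎)
  x<y (y≤z ½ε (0<r*p ½ 0<ε))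
  where
  open ℚ.≤-Reasoning
  ½ε = ½ ℚ.* ε

≤-<-trans : x ≤ y → y < z → x < z
≤-<-trans {x} {y} {z} x≤y (ε , 0<ε , y<z) = ½ε , 0<r*p ½ 0<ε , combine
  (λ n h k → begin
    seq x n ℚ.+ ½ε           ≤⟨ ℚ.+-monoˡ-≤ ½ε h ⟩
    seq y n ℚ.+ ½ε ℚ.+ ½ε
      ≡⟨ solve 2 (λ y ε → y :+ con ½ :* ε :+ con ½ :* ε := y :+ ε) refl (seq y n) ε ⟩
    seq y n ℚ.+ ε            ≤⟨ k ⟩
    seq z n                  ∎)
  (x≤y ½ε (0<r*p ½ 0<ε)) y<z
  where
  open ℚ.≤-Reasoning
  ½ε = ½ ℚ.* ε

<-irrefl : ¬ x < x
<-irrefl {x} (ε , 0<ε , N , x<x) = ℚ.<-irrefl refl (ℚ.<-≤-trans (p<p+r (seq x N) 0<ε) (x<x N ℕ.≤-refl))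

≤⇒≯ : x ≤ y → ¬ y < x
≤⇒≯ {x} {y} x≤y y<x = <-irrefl {x} (≤-<-trans {x} {y} {x} x≤y y<x)

+-monoʳ-< : ∀ x → y < z → x + y < x + z
+-monoʳ-< {y} {z} x (ε , 0<ε , y<z) = ε , 0<ε , map₂
  (λ h n N≤n → subst (ℚ._≤ seq x n ℚ.+ seq z n) (sym (ℚ.+-assoc (seq x n) (seq y n) ε))
    (ℚ.+-monoʳ-≤ (seq x n) (h n N≤n)))
  y<z

0ℝ<1ℝ : 0ℝ < 1ℝ
0ℝ<1ℝ = 1ℚ , ℚ.positive⁻¹ 1ℚ , 0 , λ _ _ → ℚ.≤-refl

-- With both sequences within δ = ε / 5 of their N-th terms, comparing y N with
-- x N + 3δ decides between y n ≤ x n + 5δ and x n + δ ≤ y n for all n ≥ N.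
≮⇒≥ : ¬ x < y → y ≤ x
≮⇒≥ {x} {y} x≮y ε 0<ε with isCauchy x (⅕ ℚ.* ε) (0<r*p ⅕ 0<ε) | isCauchy y (⅕ ℚ.* ε) (0<r*p ⅕ 0<ε)
... | N₁ , near-x | N₂ , near-y = N , y≤x
  where
  open ℚ.≤-Reasoning

  N : ℕ
  N = N₁ ℕ.⊔ N₂

  δ 3δ : ℚ
  δ  = ⅕ ℚ.* ε
  3δ = δ ℚ.+ δ ℚ.+ δ

  x-close : ∀ m n → N ℕ.≤ m → N ℕ.≤ n → seq x m ℚ.≤ seq x n ℚ.+ δ
  x-close m n N≤m N≤n = ∣p-q∣≤r⇒p≤q+r (seq x m) (seq x n)
    (near-x m n (ℕ.m⊔n≤o⇒m≤o N₁ N₂ N≤m) (ℕ.m⊔n≤o⇒m≤o N₁ N₂ N≤n))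

  y-close : ∀ m n → N ℕ.≤ m → N ℕ.≤ n → seq y m ℚ.≤ seq y n ℚ.+ δ
  y-close m n N≤m N≤n = ∣p-q∣≤r⇒p≤q+r (seq y m) (seq y n)
    (near-y m n (ℕ.m⊔n≤o⇒n≤o N₁ N₂ N≤m) (ℕ.m⊔n≤o⇒n≤o N₁ N₂ N≤n))

  y≤x : ∀ n → N ℕ.≤ n → seq y n ℚ.≤ seq x n ℚ.+ ε
  y≤x n N≤n with seq y N ℚ.≤? seq x N ℚ.+ 3δ
  ... | yes h = begin
    seq y n                         ≤⟨ y-close n N N≤n ℕ.≤-refl ⟩
    seq y N ℚ.+ δ                   ≤⟨ ℚ.+-monoˡ-≤ δ h ⟩
    seq x N ℚ.+ 3δ ℚ.+ δ            ≤⟨ ℚ.+-monoˡ-≤ δ (ℚ.+-monoˡ-≤ 3δ (x-close N n ℕ.≤-refl N≤n)) ⟩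
    seq x n ℚ.+ δ ℚ.+ 3δ ℚ.+ δ
      ≡⟨ solve 2 (λ x ε → let δ = con ⅕ :* ε in x :+ δ :+ (δ :+ δ :+ δ) :+ δ := x :+ ε) refl
               (seq x n) ε ⟩
    seq x n ℚ.+ ε                   ∎
  ... | no ¬h = ⊥-elim (x≮y (δ , 0<r*p ⅕ 0<ε , N , λ k N≤k → begin
    seq x k ℚ.+ δ                   ≤⟨ ℚ.+-monoˡ-≤ δ (x-close k N N≤k ℕ.≤-refl) ⟩
    seq x N ℚ.+ δ ℚ.+ δ
      ≡⟨ solve 2 (λ x δ → x :+ δ :+ δ := x :+ (δ :+ δ :+ δ) :- δ) refl (seq x N) δ ⟩
    seq x N ℚ.+ 3δ ℚ.- δ            ≤⟨ ℚ.+-monoˡ-≤ (ℚ.- δ) (ℚ.<⇒≤ (ℚ.≰⇒> ¬h)) ⟩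
    seq y N ℚ.- δ                   ≤⟨ ℚ.+-monoˡ-≤ (ℚ.- δ) (y-close N k ℕ.≤-refl N≤k) ⟩
    seq y k ℚ.+ δ ℚ.- δ             ≡⟨ solve 2 (λ y δ → y :+ δ :- δ := y) refl (seq y k) δ ⟩
    seq y k                         ∎))

<⇒≤ : x < y → x ≤ y
<⇒≤ {x} {y} (ε , 0<ε , x<y) δ 0<δ = map₂
  (λ h n N≤n → ℚ.≤-trans (ℚ.<⇒≤ (p<p+r (seq x n) 0<ε))
    (ℚ.≤-trans (h n N≤n) (ℚ.<⇒≤ (p<p+r (seq y n) 0<δ))))
  x<y

InRange-resp-≈ : ∀ M → x ≈ y → InRange M x → InRange M y
InRange-resp-≈ {x} {y} M x≈y (-M≤x , x≤M) =
  ≤-trans { - M} {x} {y} -M≤x (≈⇒≤ {x} {y} x≈y) ,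
  ≤-trans {y} {x} {M} (≈⇒≤ {y} {x} (≈-sym {x} {y} x≈y)) x≤M

-- Truncated operations

module _ {M : ℝ} {_∙_ : Op₂ ℝ} {_⊙_ : Op₂ (Interval M)} (trunc : IsTruncationOf M _∙_ _⊙_) where
  open IsTruncationOf trunc

  truncation-comm : Commutative _≈_ _∙_ → Commutative (_≈_ on proj₁) _⊙_
  truncation-comm ∙-comm a b = ≤-antisym {u a b} {u b a}
    (≮⇒≥ {u b a} {u a b} (u≮u b a)) (≮⇒≥ {u a b} {u b a} (u≮u a b))
    where
    u v : Interval M → Interval M → ℝ
    u a b = proj₁ (a ⊙ b)
    v a b = proj₁ a ∙ proj₁ b

    v≤v : ∀ a b → v a b ≤ v b a
    v≤v a b = ≈⇒≤ {v a b} {v b a} (∙-comm (proj₁ a) (proj₁ b))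

    -- Since the claim is a negation, the cases above and below can be refuted in turn, although
    -- nothing decides which case holds.
    u≮u : ∀ a b → ¬ u a b < u b a
    u≮u a b u<u = coincide {v a b} {v b a}
      (inside a b v∈[-M,M])
      (inside b a (InRange-resp-≈ {v a b} {v b a} M (∙-comm (proj₁ a) (proj₁ b)) v∈[-M,M]))
      (∙-comm (proj₁ a) (proj₁ b))
      where
      -- The common end of all three cases: values of the two results that agree contradict the
      -- assumed gap `u<u`.
      coincide : u a b ≈ x → u b a ≈ y → x ≈ y → ⊥
      coincide {x} {y} u≈x u≈y x≈y = ≤⇒≯ {u b a} {u a b}
        (≈⇒≤ {u b a} {u a b} (≈-trans {u b a} {y} {u a b} u≈y
          (≈-sym {u a b} {y} (≈-trans {u a b} {x} {y} u≈x x≈y))))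
        u<u

      -- Commutativity of `_∙_` puts `v b a` above `M` as well, so both results are `M`; the case
      -- below is symmetric.
      M≮v : ¬ M < v a b
      M≮v M<v = coincide {M} {M}
        (above a b M<v) (above b a (<-≤-trans {M} {v a b} {v b a} M<v (v≤v a b))) (≈-refl {M})

      v≮-M : ¬ v a b < - M
      v≮-M v<-M = coincide { - M} { - M}
        (below a b v<-M) (below b a (≤-<-trans {v b a} {v a b} { - M} (v≤v b a) v<-M)) (≈-refl { - M})

      v∈[-M,M] : InRange M (v a b)
      v∈[-M,M] = ≮⇒≥ {v a b} { - M} v≮-M , ≮⇒≥ {M} {v a b} M≮v

  -- The form of `inside` suited to computation: the range condition is checked on the known value
  -- `x` and carried back to the untruncated result.
  inside-≈ : ∀ a b → proj₁ a ∙ proj₁ b ≈ x → InRange M x → proj₁ (a ⊙ b) ≈ x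
  inside-≈ {x} a b ∙≈x x∈ = ≈-trans {proj₁ (a ⊙ b)} {proj₁ a ∙ proj₁ b} {x}
    (inside a b (InRange-resp-≈ {x} {proj₁ a ∙ proj₁ b} M (≈-sym {proj₁ a ∙ proj₁ b} {x} ∙≈x) x∈)) ∙≈x

-- Failure of associativity

module _ {M : ℝ} (0<M : 0ℝ < M) {_⊞_ : Op₂ (Interval M)} (trunc : IsTruncationOf M _+_ _⊞_) where
  open IsTruncationOf trunc

  truncated-+-not-assoc : ¬ Associative (_≈_ on proj₁) _⊞_
  -- Associativity would equate the values `0ℝ` and `M` of the two bracketings; the half `M ≤ 0ℝ` of
  -- this contradicts `0<M`.
  truncated-+-not-assoc assoc = ≤⇒≯ {M} {0ℝ} M≤0 0<M
    where
    0≤M : 0ℝ ≤ M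
    0≤M = <⇒≤ {0ℝ} {M} 0<M

    M-M≈0 : M + - M ≈ 0ℝ
    M-M≈0 = +-inverseʳ M

    -M≤0 : - M ≤ 0ℝ
    -- Add `- M` to both sides of `0≤M`.
    -M≤0 = ≤-trans { - M} {0ℝ + - M} {0ℝ}
      (pointwise⇒≤ { - M} {0ℝ + - M} λ n → sym (ℚ.+-identityˡ (seq (- M) n)))
      (≤-trans {0ℝ + - M} {M + - M} {0ℝ}
        (+-mono-≤ {0ℝ} {M} { - M} { - M} 0≤M (≤-refl { - M})) (≈⇒≤ {M + - M} {0ℝ} M-M≈0))

    -M≤M : - M ≤ M
    -M≤M = ≤-trans { - M} {0ℝ} {M} -M≤0 0≤M

    -- Here truncation takes effect: the strict excess over `M` lets `above` apply to the sum of `⊤`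
    -- with itself.
    M<M+M : M < M + M
    M<M+M = ≤-<-trans {M} {M + 0ℝ} {M + M}
      (≈⇒≤ {M} {M + 0ℝ} (≈-sym {M + 0ℝ} {M} (+-identityʳ M))) (+-monoʳ-< {0ℝ} {M} M 0<M)

    ⊤ -⊤ M⊞M M⊞-M : Interval M
    ⊤     = M , -M≤M , ≤-refl {M}
    -⊤    = - M , ≤-refl { - M} , -M≤M
    M⊞M   = ⊤ ⊞ ⊤
    M⊞-M  = ⊤ ⊞ -⊤

    M⊞-M≈0 : proj₁ M⊞-M ≈ 0ℝ
    M⊞-M≈0 = inside-≈ trunc {0ℝ} ⊤ -⊤ M-M≈0 (-M≤0 , 0≤M)

    [M⊞M]⊞-M≈0 : proj₁ (M⊞M ⊞ -⊤) ≈ 0ℝ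
    [M⊞M]⊞-M≈0 = inside-≈ trunc {0ℝ} M⊞M -⊤
      -- By `above` the inner sum is `M` up to `_≈_`, so `+-cong` replaces it before `- M` cancels.
      (≈-trans {proj₁ M⊞M + - M} {M + - M} {0ℝ}
        (+-cong {proj₁ M⊞M} {M} { - M} { - M} (above ⊤ ⊤ M<M+M) (≈-refl { - M})) M-M≈0)
      (-M≤0 , 0≤M)

    M⊞[M⊞-M]≈M : proj₁ (⊤ ⊞ M⊞-M) ≈ M
    M⊞[M⊞-M]≈M = inside-≈ trunc {M} ⊤ M⊞-M
      (≈-trans {M + proj₁ M⊞-M} {M + 0ℝ} {M}
        (+-cong {M} {M} {proj₁ M⊞-M} {0ℝ} (≈-refl {M}) M⊞-M≈0) (+-identityʳ M))
      -- The value `M` is an endpoint; the range is closed, so this sum falls under `inside`.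
      (-M≤M , ≤-refl {M})

    M≤0 : M ≤ 0ℝ
    M≤0 = ≈⇒≤ {M} {0ℝ} (≈-sym {0ℝ} {M} (≈-trans {0ℝ} {proj₁ (M⊞M ⊞ -⊤)} {M}
      (≈-sym {proj₁ (M⊞M ⊞ -⊤)} {0ℝ} [M⊞M]⊞-M≈0)
      (≈-trans {proj₁ (M⊞M ⊞ -⊤)} {proj₁ (⊤ ⊞ M⊞-M)} {M} (assoc ⊤ ⊤ -⊤) M⊞[M⊞-M]≈M)))

mainTheorem4 : ∀ (M : ℝ) → 1ℝ ≤ M → (𝐀 : TruncatedAlgebra M) →
    let open TruncatedAlgebra 𝐀 in
    Commutative _≈ᴵ_ _⊞_
    × ¬ Associative _≈ᴵ_ _⊞_
    × ¬ (∃₂ λ 0# 1# → IsSemiring _≈ᴵ_ _⊞_ _⊠_ 0# 1#)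
mainTheorem4 M 1≤M 𝐀 =
  truncation-comm ⊞-isTruncationOf +-comm ,
  ⊞-not-assoc ,
  -- Associativity of addition is part of any semiring structure, whatever its zero and one.
  λ (_ , _ , isSemiring) → ⊞-not-assoc (IsSemiring.+-assoc isSemiring)
  where
  open TruncatedAlgebra 𝐀

  ⊞-not-assoc : ¬ Associative _≈ᴵ_ _⊞_
  -- Positivity of `M` comes from 0 < 1 and 1 ≤ M.
  ⊞-not-assoc = truncated-+-not-assoc (<-≤-trans {0ℝ} {1ℝ} {M} 0ℝ<1ℝ 1≤M) ⊞-isTruncationOf
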